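{- Every connected locally Dirac graph $G$ of order at least $3$ is fully cycle extendable.
   Context: All graphs are finite, simple, and undirected. $n(G)$ is the order and $\delta(G)$ the minimum degree of $G$; $N_G(u)$ is the (open) neighborhood and $d_G(u)$ the degree of $u$ in $G$. $G$ is locally Dirac if $2\delta(G[N_G(u)])\geq d_G(u)$ for every vertex $u$ of $G$, where $G[N_G(u)]$ is the subgraph of $G$ induced by $N_G(u)$. A cycle $C$ in $G$ is extendable if $G$ contains a cycle $C'$ of order $n(C)+1$ with $V(C)\subseteq V(C')$. $G$ is fully cycle extendable if every vertex of $G$ lies on a triangle and every cycle in $G$ of order less than $n(G)$ is extendable. -}

module Defs where

open import Data.Fin.Base using (Fin)
open import Data.List.Base using (List; []; _∷_; _∷ʳ_; length; lookup; filter; map; allFin)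
open import Data.List.Extrema.Nat using (min)
open import Data.List.Membership.Propositional using (_∈_)
open import Data.List.Relation.Binary.Subset.Propositional using (_⊆_)
open import Data.List.Relation.Unary.Linked using (Linked)
open import Data.List.Relation.Unary.Unique.Propositional using (Unique)
open import Data.Nat.Base using (ℕ; suc; _*_; _≤_; _<_; _≥_)
open import Data.Product.Base using (∃; _×_)
open import Level using (0ℓ)
open import Relation.Binary.Construct.Closure.ReflexiveTransitive using (Star)
open import Relation.Binary.Core using (Rel)
open import Relation.Binary.Definitions using (Symmetric; Decidable; Irreflexive)
open import Relation.Binary.PropositionalEquality using (_≡_; refl)

record Graph (n : ℕ) : Set₁ where
  infix 4 _~_ _~?_
  field
    _~_    : Rel (Fin n) 0ℓ
    _~?_   : Decidable _~_
    sym    : Symmetric _~_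
    irrefl : Irreflexive _≡_ _~_

module _ {n : ℕ} (G : Graph n) where
  open Graph G

  -- Duplicate-free, since allFin n is.
  neighbours : Fin n → List (Fin n)
  neighbours u = filter (u ~?_) (allFin n)

  degree : Fin n → ℕ
  degree u = length (neighbours u)

  -- The bound n exceeds every degree, so it is attained only when n = 0,
  -- where it gives minimum degree 0.
  minDegree : ℕ
  minDegree = min n (map degree (allFin n))

  -- Vertex i of the induced subgraph is the i-th entry of xs, which is
  -- meant to be duplicate-free.
  induced : (xs : List (Fin n)) → Graph (length xs)
  induced xs = record
    { _~_    = λ i j → lookup xs i ~ lookup xs j
    ; _~?_   = λ i j → lookup xs i ~? lookup xs j
    ; sym    = sym
    ; irrefl = λ { refl → irrefl refl }
    }

  Connected : Set
  Connected = ∀ u v → Star _~_ u v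

  -- A cycle is given by a cyclic listing of its vertices from a chosen start.
  record Cycle : Set where
    field
      start    : Fin n
      rest     : List (Fin n)

    vertices : List (Fin n)
    vertices = start ∷ rest

    order : ℕ
    order = length vertices

    field
      3≤order  : 3 ≤ order
      distinct : Unique vertices
      closed   : Linked _~_ (vertices ∷ʳ start)

  open Cycle

  Extendable : Cycle → Set
  Extendable C = ∃ λ (C′ : Cycle) → order C′ ≡ suc (order C) × vertices C ⊆ vertices C′

  OnTriangle : Fin n → Set
  OnTriangle u = ∃ λ (T : Cycle) → order T ≡ 3 × u ∈ vertices T

  FullyCycleExtendable : Set
  FullyCycleExtendable =
    (∀ u → OnTriangle u) × (∀ (C : Cycle) → order C < n → Extendable C)

LocallyDirac : ∀ {n} → Graph n → Set
LocallyDirac G = ∀ u → 2 * minDegree (induced G (neighbours G u)) ≥ degree G u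

{-# OPTIONS --safe #-}

-- Let x ∉ C be adjacent to a vertex of C, and let w⁺ be the successor of w on
-- an orientation of C.  If C is not extendable, then
--   (i)  no vertex off C is adjacent to both w and w⁺, and
--   (ii) w⁺ ≁ v⁺ for any two neighbours w, v of x on C, since otherwise
--        x, w, …, v⁺, w⁺, …, v is a cycle (with w, …, v⁺ traversed backwards).
-- Fix a neighbour w ∈ C of x.  As x and w⁺ have at least d(w)/2 neighbours each
-- in N(w), at least as many vertices of N(w) are adjacent to both as to neither.
-- By (i) the former are neighbours v ∈ C of x with v ~ w⁺; by (i) and (ii) the
-- latter include x and every v⁺ ~ w with v a neighbour of x on C.  Hence
--   1 + #{v : v⁺ ~ w} ≤ #{v : v ~ w⁺},
-- and summing over w counts the same pairs on both sides, a contradiction.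
module Submission where

open import Data.Bool.Base using (true; false)
open import Data.Fin.Base using (Fin)
open import Data.Fin.Properties using (_≟_)
open import Data.List.Base using (List; []; _∷_; _++_; _∷ʳ_; length; lookup; filter; map; allFin)
open import Data.List.Extrema.Nat using (min≤xs)
open import Data.List.Membership.Propositional using (_∈_; _∉_; lose; find)
open import Data.List.Membership.Propositional.Properties
  using (∈-∃++; ∈-filter⁺; ∈-filter⁻; ∈-allFin; ∈-map⁺; ∈-map⁻; ∈-length)
open import Data.List.Properties
  using (length-map; length-tabulate; map-tabulate; tabulate-lookup; map-cong)
open import Data.List.Relation.Binary.Permutation.Propositional
  using (_↭_; ↭⇒↭ₛ; ↭-refl; ↭-reflexive; ↭-sym; ↭-trans; prep)
open import Data.List.Relation.Binary.Permutation.Propositional.Properties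
  using (↭-length; ∈-resp-↭; ++-comm; ++⁺ʳ; shift; ∷↭∷ʳ)
import Data.List.Relation.Binary.Permutation.Setoid.Properties as Permutation
open import Data.List.Relation.Binary.Subset.Propositional using (_⊆_)
open import Data.List.Relation.Unary.All as All using ([]; _∷_)
open import Data.List.Relation.Unary.All.Properties using (¬Any⇒All¬)
import Data.List.Relation.Unary.AllPairs as AllPairs
import Data.List.Relation.Unary.AllPairs.Properties as AllPairs
open import Data.List.Relation.Unary.Any using (here; there; any?; index)
open import Data.List.Relation.Unary.Any.Properties using (lookup-index)
open import Data.List.Relation.Unary.Linked using (Linked; [-]; _∷_)
open import Data.List.Relation.Unary.Unique.Propositional using (Unique; []; _∷_)
open import Data.List.Relation.Unary.Unique.Propositional.Properties using (allFin⁺; filter⁺)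
open import Data.Nat.Base using (ℕ; suc; _+_; _*_; _≤_; _<_; _≥_; z≤n; s≤s)
open import Data.Nat.ListAction using (sum)
open import Data.Nat.Properties
  using (+-suc; +-identityʳ; +-mono-≤; +-monoˡ-≤; +-monoʳ-≤; +-cancelˡ-≤; *-monoʳ-≤;
         ≤-refl; ≤-trans; ≤-reflexive; ≤-total; <-irrefl; <⇒≤; <⇒≱; m≤n⇒m≤1+n; +-comm; module ≤-Reasoning)
open import Data.Nat.Tactic.RingSolver using (solve-∀)
open import Data.Product.Base using (∃; ∃₂; _×_; _,_; proj₁; proj₂)
open import Data.Sum.Base using (inj₁; inj₂)
open import Function.Base using (_∘_; id)
open import Level using (Level)
open import Relation.Binary.Construct.Closure.ReflexiveTransitive using (Star; ε; _◅_)
import Relation.Binary.Definitions as Binary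
open import Relation.Binary.PropositionalEquality
  using (_≡_; _≢_; refl; sym; trans; cong; cong₂; subst; setoid)
open import Relation.Nullary using (¬_; yes; no; does; contradiction)
open import Relation.Nullary.Decidable using (_×-dec_; ¬?)
open import Relation.Unary using (Pred; Decidable)
open import Defs

private variable
  a p q r : Level
  A B : Set a

-- Counting in lists.

count : {P : Pred A p} → Decidable P → List A → ℕ
count P? xs = length (filter P? xs)

count-∘ : {P : Pred B p} (P? : Decidable P) (f : A → B) (xs : List A) →
          count (P? ∘ f) xs ≡ count P? (map f xs)
count-∘ P? f [] = refl
count-∘ P? f (x ∷ xs) with ih ← count-∘ P? f xs | does (P? (f x))
... | true  = cong suc ih
... | false = ih

-- Vertices of an induced subgraph are positions in a list; this turns degrees there into counts
-- over the list itself.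
count-lookup : {P : Pred A p} (P? : Decidable P) (xs : List A) →
               count (P? ∘ lookup xs) (allFin (length xs)) ≡ count P? xs
count-lookup P? xs = trans (count-∘ P? (lookup xs) (allFin (length xs)))
  (cong (count P?) (trans (map-tabulate id (lookup xs)) (tabulate-lookup xs)))

module _ {P : Pred A p} {Q : Pred A q} (P? : Decidable P) (Q? : Decidable Q) where

  private
    both?    = λ x → P? x ×-dec Q? x
    neither? = λ x → ¬? (P? x) ×-dec ¬? (Q? x)

  -- Inclusion-exclusion without subtraction: an element with both properties adds two to each side,
  -- any other element adds one.
  count-∧+length : ∀ xs →
    count both? xs + length xs ≡ count P? xs + count Q? xs + count neither? xs
  count-∧+length [] = refl
  count-∧+length (x ∷ xs) with ih ← count-∧+length xs | does (P? x) | does (Q? x)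
  ... | true  | true  = trans (cong suc (+-suc _ _))
    (trans (cong (suc ∘ suc) ih) (cong (λ k → suc (k + count neither? xs)) (sym (+-suc (count P? xs) _))))
  ... | true  | false = trans (+-suc _ _) (cong suc ih)
  ... | false | true  = trans (+-suc _ _)
    (trans (cong suc ih) (cong (_+ count neither? xs) (sym (+-suc (count P? xs) _))))
  ... | false | false = trans (+-suc _ _) (trans (cong suc ih) (sym (+-suc _ _)))

  count-neither≤count-both : ∀ xs → length xs ≤ 2 * count P? xs → length xs ≤ 2 * count Q? xs →
    count neither? xs ≤ count both? xs
  count-neither≤count-both xs hp hq = +-cancelˡ-≤ (length xs) _ _ (begin
    length xs + count neither? xs                  ≤⟨ +-monoˡ-≤ _ (half (count P? xs) (count Q? xs) hp hq) ⟩
    count P? xs + count Q? xs + count neither? xs  ≡⟨ count-∧+length xs ⟨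
    count both? xs + length xs                     ≡⟨ +-comm _ (length xs) ⟩
    length xs + count both? xs                     ∎)
    where
    open ≤-Reasoning
    -- The sum is at least twice the smaller summand.
    half : ∀ {k} i j → k ≤ 2 * i → k ≤ 2 * j → k ≤ i + j
    half i j k≤2i k≤2j rewrite +-identityʳ i | +-identityʳ j with ≤-total i j
    ... | inj₁ i≤j = ≤-trans k≤2i (+-monoʳ-≤ i i≤j)
    ... | inj₂ j≤i = ≤-trans k≤2j (+-monoˡ-≤ j j≤i)

Unique-⊆⇒length≤ : {xs ys : List A} → Unique xs → xs ⊆ ys → length xs ≤ length ys
Unique-⊆⇒length≤ [] _ = z≤n
Unique-⊆⇒length≤ {xs = x ∷ xs} (x∉xs ∷ xs!) sub with ∈-∃++ (sub (here refl))
... | as , bs , refl = ≤-trans (s≤s (Unique-⊆⇒length≤ xs! sub′))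
                         (≤-reflexive (sym (↭-length (shift x as bs))))
  where
  sub′ : xs ⊆ as ++ bs
  sub′ z∈xs with ∈-resp-↭ (shift x as bs) (sub (there z∈xs))
  ... | here refl = contradiction refl (All.lookup x∉xs z∈xs)
  ... | there z∈  = z∈

Unique-resp-↭ : {xs ys : List A} → xs ↭ ys → Unique xs → Unique ys
Unique-resp-↭ = Permutation.Unique-resp-↭ (setoid _) ∘ ↭⇒↭ₛ

-- Double counting of a relation.

sum-map-+ : (f g : A → ℕ) (xs : List A) →
            sum (map (λ x → f x + g x) xs) ≡ sum (map f xs) + sum (map g xs)
sum-map-+ f g []       = refl
sum-map-+ f g (x ∷ xs) rewrite sum-map-+ f g xs = interchange (f x) (g x) _ _
  where
  interchange : ∀ a b c d → a + b + (c + d) ≡ a + c + (b + d)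
  interchange = solve-∀

sum-map-mono-< : {f g : A → ℕ} {x : A} (xs : List A) → (∀ {y} → y ∈ x ∷ xs → f y < g y) →
                 sum (map f (x ∷ xs)) < sum (map g (x ∷ xs))
sum-map-mono-< []       f<g = +-mono-≤ (f<g (here refl)) z≤n
sum-map-mono-< (_ ∷ xs) f<g =
  +-mono-≤ (f<g (here refl)) (<⇒≤ (sum-map-mono-< xs (f<g ∘ there)))

module _ {R : A → A → Set r} (R? : Binary.Decidable R) where

  sum-count-swap : ∀ xs ys → sum (map (λ x → count (λ y → R? x y) ys) xs) ≡
                             sum (map (λ y → count (λ x → R? x y) xs) ys)
  sum-count-swap []       ys = sym (zeros ys)
    where
    zeros : ∀ (zs : List A) → sum (map (λ _ → 0) zs) ≡ 0
    zeros []       = refl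
    zeros (_ ∷ zs) = zeros zs
  sum-count-swap (x ∷ xs) ys = trans (cong₂ _+_ (count-as-sum ys) (sum-count-swap xs ys))
    (trans (sym (sum-map-+ (λ y → count (λ x → R? x y) (x ∷ [])) _ ys)) (cong sum (map-cong count-∷ ys)))
    where
    -- The indicator of `R x y` is written as a count over `x ∷ []`, so that adding the count over
    -- `xs` gives the count over `x ∷ xs`.
    count-as-sum : ∀ ys → count (R? x) ys ≡ sum (map (λ y → count (λ x → R? x y) (x ∷ [])) ys)
    count-as-sum []       = refl
    count-as-sum (y ∷ ys) with does (R? x y)
    ... | true  = cong suc (count-as-sum ys)
    ... | false = count-as-sum ys
    count-∷ : ∀ y → count (λ x → R? x y) (x ∷ []) + count (λ x → R? x y) xs ≡ count (λ x → R? x y) (x ∷ xs)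
    count-∷ y with does (R? x y)
    ... | true  = refl
    ... | false = refl

  -- In-degrees and out-degrees have the same sum; the member `x` makes the list nonempty, so
  -- pointwise strictness would make the sums differ.
  ¬in-degree<out-degree : ∀ {x xs} → x ∈ xs →
    ¬ (∀ y → y ∈ xs → count (λ z → R? z y) xs < count (λ z → R? y z) xs)
  ¬in-degree<out-degree {xs = xs@(_ ∷ xs′)} _ in<out =
    <-irrefl (sym (sum-count-swap xs xs)) (sum-map-mono-< xs′ (in<out _))

-- Neighbourhoods in locally Dirac graphs.

minDegree≤degree : ∀ {n} (G : Graph n) u → minDegree G ≤ degree G u
minDegree≤degree {n} G u =
  All.lookup (min≤xs n (map (degree G) (allFin n))) (∈-map⁺ (degree G) (∈-allFin u))

module _ {n : ℕ} (G : Graph n) where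
  open Graph G renaming (sym to ~-sym; irrefl to ~-irrefl)

  private variable
    s t u v w x y : Fin n
    l : List (Fin n)

  ∈-neighbours⁺ : u ~ v → v ∈ neighbours G u
  ∈-neighbours⁺ {u} u~v = ∈-filter⁺ (u ~?_) (∈-allFin _) u~v

  ∈-neighbours⁻ : v ∈ neighbours G u → u ~ v
  ∈-neighbours⁻ {u = u} v∈ = proj₂ (∈-filter⁻ (u ~?_) {xs = allFin n} v∈)

  neighbours-Unique : ∀ u → Unique (neighbours G u)
  neighbours-Unique u = filter⁺ (u ~?_) (allFin⁺ n)

  module _ (dirac : LocallyDirac G) where

    -- The degree of `v` in the subgraph induced by the neighbours of `u` is at least the minimum
    -- degree there, and it counts the common neighbours of `u` and `v`.
    dirac-count : u ~ v → length (neighbours G u) ≤ 2 * count (v ~?_) (neighbours G u)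
    dirac-count {u} {v} u~v = ≤-trans (dirac u) (*-monoʳ-≤ 2 (begin
      minDegree H                              ≤⟨ minDegree≤degree H i ⟩
      degree H i                               ≡⟨ count-lookup (lookup N i ~?_) N ⟩
      count (lookup N i ~?_) N                 ≡⟨ cong (λ z → count (z ~?_) N) (sym (lookup-index v∈N)) ⟩
      count (v ~?_) N                          ∎))
      where
      open ≤-Reasoning
      N   = neighbours G u
      H   = induced G N
      v∈N = ∈-neighbours⁺ u~v
      i   = index v∈N

    edge-in-triangle : u ~ v → ∃ λ w → u ~ w × v ~ w
    edge-in-triangle {u} {v} u~v with filter (v ~?_) (neighbours G u) in eq | dirac-count u~v
    ... | []    | d≤0 = contradiction (≤-trans (∈-length (∈-neighbours⁺ u~v)) d≤0) λ ()
    ... | w ∷ _ | _ with ∈-filter⁻ (v ~?_) {xs = neighbours G u} (subst (w ∈_) (sym eq) (here refl))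
    ... | w∈ , v~w = w , ∈-neighbours⁻ w∈ , v~w

  -- Walks, with both ends included in the vertex list.

  data Walk : Fin n → Fin n → List (Fin n) → Set where
    [_] : ∀ u → Walk u u (u ∷ [])
    _∷_ : u ~ v → Walk v w l → Walk u w (u ∷ l)

  steps : Walk u v l → List (Fin n × Fin n)
  steps [ _ ]                     = []
  steps (_∷_ {u = u} {v = v} _ W) = (u , v) ∷ steps W

  private variable
    l₁ l₂ : List (Fin n)

  join : Walk u v l₁ → v ~ w → Walk w x l₂ → Walk u x (l₁ ++ l₂)
  join [ _ ]   e W₂ = e ∷ W₂
  join (d ∷ W) e W₂ = d ∷ join W e W₂

  steps-join : (W₁ : Walk u v l₁) (e : v ~ w) (W₂ : Walk w x l₂) →
               steps (join W₁ e W₂) ≡ steps W₁ ++ (v , w) ∷ steps W₂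
  steps-join [ _ ]    e W₂ = refl
  steps-join (_ ∷ W₁) e W₂ = cong (_ ∷_) (steps-join W₁ e W₂)

  step-split : (W : Walk u v l) → (x , y) ∈ steps W →
    x ~ y × ∃₂ λ l₁ l₂ → ∃₂ λ (W₁ : Walk u x l₁) (W₂ : Walk y v l₂) →
      l ≡ l₁ ++ l₂ × steps W ≡ steps W₁ ++ (x , y) ∷ steps W₂
  step-split (e ∷ W) (here refl) = e , _ , _ , [ _ ] , W , refl , refl
  step-split (e ∷ W) (there p) with step-split W p
  ... | d , _ , _ , W₁ , W₂ , refl , eq = d , _ , _ , e ∷ W₁ , W₂ , refl , cong (_ ∷_) eq

  reverse : Walk u v l → ∃ λ l′ → Walk v u l′ × l′ ↭ l
  reverse [ u ] = _ , [ u ] , ↭-refl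
  reverse (_∷_ {u = u} {l = l} e W) with reverse W
  ... | l′ , W′ , l′↭l = l′ ∷ʳ u , join W′ (~-sym e) [ u ] ,
                         ↭-trans (↭-sym (∷↭∷ʳ u l′)) (prep u l′↭l)

  sources : (W : Walk u v l) → map proj₁ (steps W) ∷ʳ v ≡ l
  sources [ _ ]   = refl
  sources (_ ∷ W) = cong (_ ∷_) (sources W)

  targets : (W : Walk u v l) → u ∷ map proj₂ (steps W) ≡ l
  targets [ _ ]   = refl
  targets (_ ∷ W) = cong (_ ∷_) (targets W)

  -- Passing between cycles and closed walks.

  fromLinked : ∀ u l → Linked _~_ ((u ∷ l) ∷ʳ s) → ∃ λ t → Walk u t (u ∷ l) × t ~ s
  fromLinked u []      (e ∷ _) = u , [ u ] , e
  fromLinked u (v ∷ l) (d ∷ L) with fromLinked v l L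
  ... | t , W , e = t , d ∷ W , e

  toLinked : Walk u t l → t ~ s → Linked _~_ (l ∷ʳ s)
  toLinked [ _ ]         e = e ∷ [-]
  toLinked (d ∷ [ v ])   e = d ∷ e ∷ [-]
  toLinked (d ∷ (c ∷ W)) e = d ∷ toLinked (c ∷ W) e

  starts-at : Walk u v l → ∃ λ l′ → l ≡ u ∷ l′
  starts-at W = _ , sym (targets W)

  toCycle : Walk s t l → t ~ s → 3 ≤ length l → Unique l → ∃ λ C → Cycle.vertices {G = G} C ≡ l
  toCycle {s} W e 3≤ l! with starts-at W
  ... | _ , refl = record { start = s ; 3≤order = 3≤ ; distinct = l! ; closed = toLinked W e } , refl

  -- Distinctness and length are not recorded: both are carried over from `l` by the permutation.
  Insertion : List (Fin n) → Set
  Insertion l = ∃₂ λ s t → ∃₂ λ x l′ → Walk s t l′ × t ~ s × x ∉ l × l′ ↭ x ∷ l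

  extend : ∀ C → Insertion (Cycle.vertices {G = G} C) → Extendable G C
  extend C (s , t , x , l′ , W , e , x∉ , l′↭)
    with toCycle W e
           (subst (3 ≤_) (sym (↭-length l′↭)) (m≤n⇒m≤1+n (Cycle.3≤order C)))
           (Unique-resp-↭ (↭-sym l′↭) (¬Any⇒All¬ _ x∉ ∷ Cycle.distinct C))
  ... | C′ , refl = C′ , ↭-length l′↭ , ∈-resp-↭ (↭-sym l′↭) ∘ there

  -- Inserting a vertex into a closed walk.

  module ClosedWalk (W : Walk s t l) (e : t ~ s) where

    -- With the closing arc first, the targets are `l` itself, while the sources are `l` with its
    -- last vertex moved to the front.
    arcs : List (Fin n × Fin n)
    arcs = (t , s) ∷ steps W

    arc-targets : map proj₂ arcs ≡ l
    arc-targets = targets W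

    arc-sources : map proj₁ arcs ↭ l
    arc-sources = ↭-trans (∷↭∷ʳ t _) (↭-reflexive (sources W))

    arc⇒~ : (x , y) ∈ arcs → x ~ y
    arc⇒~ (here refl) = e
    arc⇒~ (there p)   = proj₁ (step-split W p)

    -- Cutting at the given arc and rejoining the two pieces through `e` makes that arc the closing
    -- one.
    rotate : (x , y) ∈ arcs → ∃₂ λ l′ (R : Walk y x l′) → l′ ↭ l × arcs ↭ (x , y) ∷ steps R
    rotate (here refl) = l , W , ↭-refl , ↭-refl
    rotate (there p) with step-split W p
    ... | _ , l₁ , l₂ , W₁ , W₂ , refl , eq =
      l₂ ++ l₁ , join W₂ e W₁ , ++-comm l₂ l₁ ,
      ↭-trans (↭-reflexive (cong (_ ∷_) eq))
        (↭-trans (++-comm ((t , s) ∷ steps W₁) _)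
          (↭-reflexive (cong (_ ∷_) (sym (steps-join W₂ e W₁)))))

    insert-in-arc : (x , y) ∈ arcs → v ∉ l → x ~ v → v ~ y → Insertion l
    insert-in-arc {x} {y} {v} p v∉l x~v v~y with rotate p
    ... | l′ , R , l′↭l , _ = v , x , v , v ∷ l′ , v~y ∷ R , x~v , v∉l , prep v l′↭l

    insert-crossing : ∀ {x x⁺ y y⁺} → (x , x⁺) ∈ arcs → (y , y⁺) ∈ arcs →
                      v ∉ l → v ~ x → v ~ y → x⁺ ~ y⁺ → Insertion l
    insert-crossing {v} p q v∉l v~x v~y x⁺~y⁺ with rotate p
    ... | _ , R , l′↭l , arcs↭ with ∈-resp-↭ arcs↭ q
    -- If the arcs coincide, `x⁺` would be adjacent to itself.
    ... | here refl = contradiction x⁺~y⁺ (~-irrefl refl)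
    ... | there q′ with step-split R q′
    ... | _ , l₁ , l₂ , W₁ , W₂ , refl , _ with reverse W₁
    -- `W₁` runs from `x⁺` to `y` and `W₂` from `y⁺` to `x`. With `W₁` reversed, the chord `x⁺~y⁺`
    -- joins them, and `v` closes the gap between `x` and `y`.
    ... | l₁′ , W₁′ , l₁′↭l₁ =
      v , _ , v , v ∷ l₁′ ++ l₂ , v~y ∷ join W₁′ x⁺~y⁺ W₂ , ~-sym v~x , v∉l ,
      prep v (↭-trans (++⁺ʳ l₂ l₁′↭l₁) l′↭l)

    -- Degree comparison for a vertex off the closed walk.

    module _ (l! : Unique l) (x∉l : x ∉ l) where

      -- The pairs (w , w⁺) with w ~ x, viewed as the vertices of a digraph with
      -- an edge from (w , w⁺) to (v , v⁺) when w⁺ ~ v.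
      P : List (Fin n × Fin n)
      P = filter (λ a → x ~? proj₁ a) arcs

      P⊆arcs : ∀ {a} → a ∈ P → a ∈ arcs × x ~ proj₁ a
      P⊆arcs = ∈-filter⁻ (λ a → x ~? proj₁ a) {xs = arcs}

      -- Stated on arcs rather than on the list of targets, so that it survives filtering the arcs.
      targets! : AllPairs.AllPairs (λ a b → proj₂ a ≢ proj₂ b) arcs
      targets! = AllPairs.map⁻ (subst Unique (sym arc-targets) l!)

      out-degree>in-degree :
        LocallyDirac G →
        (∀ {v a} → v ∉ l → a ∈ arcs → proj₁ a ~ v → ¬ (v ~ proj₂ a)) →
        (∀ {a b} → a ∈ P → b ∈ P → ¬ (proj₂ a ~ proj₂ b)) →
        ∀ a → a ∈ P →
        count (λ b → proj₂ b ~? proj₁ a) P < count (λ b → proj₂ a ~? proj₁ b) P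
      out-degree>in-degree dirac no-insert no-cross (w , w⁺) a∈P = begin-strict
        count (λ b → proj₂ b ~? w) P       ≡⟨ length-map proj₂ ins ⟨
        -- Strict because `x` joins the targets of `ins` as one more vertex adjacent to neither `x`
        -- nor `w⁺`.
        length (map proj₂ ins)             <⟨ Unique-⊆⇒length≤ x-ins! x-ins⊆ ⟩
        count neither? (neighbours G w)    ≤⟨ count-neither≤count-both (x ~?_) (w⁺ ~?_) (neighbours G w)
                                                (dirac-count dirac (~-sym x~w)) (dirac-count dirac w~w⁺) ⟩
        count both? (neighbours G w)       ≤⟨ Unique-⊆⇒length≤ (filter⁺ both? (neighbours-Unique w)) both⊆ ⟩
        length (map proj₁ outs)            ≡⟨ length-map proj₁ outs ⟩
        count (λ b → w⁺ ~? proj₁ b) P      ∎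
        where
        open ≤-Reasoning
        a∈arcs = proj₁ (P⊆arcs a∈P)
        x~w    = proj₂ (P⊆arcs a∈P)
        w~w⁺   = arc⇒~ a∈arcs
        outs = filter (λ b → w⁺ ~? proj₁ b) P
        ins  = filter (λ b → proj₂ b ~? w) P
        both?    = λ z → (x ~? z) ×-dec (w⁺ ~? z)
        neither? = λ z → ¬? (x ~? z) ×-dec ¬? (w⁺ ~? z)

        ins⇒ : ∀ {b} → b ∈ ins → b ∈ P × proj₂ b ~ w
        ins⇒ = ∈-filter⁻ (λ b → proj₂ b ~? w) {xs = P}

        x-ins! : Unique (x ∷ map proj₂ ins)
        x-ins! = All.tabulate (λ z∈ → λ { refl → x∉ins z∈ })
               ∷ AllPairs.map⁺ (AllPairs.filter⁺ (λ b → proj₂ b ~? w)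
                   (AllPairs.filter⁺ (λ a → x ~? proj₁ a) targets!))
          where
          x∉ins : x ∉ map proj₂ ins
          x∉ins x∈ with ∈-map⁻ proj₂ x∈
          ... | b , b∈ , refl =
            x∉l (subst (_ ∈_) arc-targets (∈-map⁺ proj₂ (proj₁ (P⊆arcs (proj₁ (ins⇒ b∈))))))

        x-ins⊆ : x ∷ map proj₂ ins ⊆ filter neither? (neighbours G w)
        x-ins⊆ (here refl) = ∈-filter⁺ neither? (∈-neighbours⁺ (~-sym x~w))
          (~-irrefl refl , λ w⁺~x → no-insert x∉l a∈arcs (~-sym x~w) (~-sym w⁺~x))
        x-ins⊆ (there z∈) with ∈-map⁻ proj₂ z∈
        ... | b , b∈ , refl with ins⇒ b∈
        -- If `x` were adjacent to this target, it would fit into the arc `b`; if `w⁺` were, `b`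
        -- would cross `(w , w⁺)`.
        ... | b∈P , z~w = ∈-filter⁺ neither? (∈-neighbours⁺ (~-sym z~w))
          (no-insert x∉l (proj₁ (P⊆arcs b∈P)) (~-sym (proj₂ (P⊆arcs b∈P))) , no-cross a∈P b∈P)

        both⊆ : filter both? (neighbours G w) ⊆ map proj₁ outs
        both⊆ {z} z∈ with ∈-filter⁻ both? {xs = neighbours G w} z∈
        ... | z∈N , x~z , w⁺~z with any? (z ≟_) l
        -- Off `l`, the vertex `z` would fit between `w` and `w⁺`.
        ... | no z∉l = contradiction (~-sym w⁺~z) (no-insert z∉l a∈arcs (∈-neighbours⁻ z∈N))
        ... | yes z∈l with ∈-map⁻ proj₁ (∈-resp-↭ (↭-sym arc-sources) z∈l)
        ... | b , b∈arcs , refl =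
          ∈-map⁺ proj₁ (∈-filter⁺ (λ b → w⁺ ~? proj₁ b)
            (∈-filter⁺ (λ a → x ~? proj₁ a) b∈arcs x~z) w⁺~z)

      -- Decidability turns the argument by contradiction into a search: first for any vertex off
      -- `l` fitting into an arc, then for a crossing pair in `P`. If both fail, the degree count is
      -- contradictory.
      insertion : LocallyDirac G → u ∈ l → x ~ u → Insertion l
      insertion dirac u∈l x~u
        with any? (λ v → ¬? (any? (v ≟_) l) ×-dec
                       any? (λ a → (proj₁ a ~? v) ×-dec (v ~? proj₂ a)) arcs) (allFin n)
           | any? (λ a → any? (λ b → proj₂ a ~? proj₂ b) P) P
      ... | yes found | _ with find found
      ... | v , _ , v∉l , found′ with find found′
      ... | a , a∈ , a₁~v , v~a₂ = insert-in-arc a∈ v∉l a₁~v v~a₂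
      insertion dirac u∈l x~u | no _ | yes found with find found
      ... | a , a∈P , found′ with find found′
      ... | b , b∈P , a₂~b₂ with P⊆arcs a∈P | P⊆arcs b∈P
      ... | a∈ , x~a₁ | b∈ , x~b₁ = insert-crossing a∈ b∈ x∉l x~a₁ x~b₁ a₂~b₂
      insertion dirac u∈l x~u | no no-insert | no no-cross
        with ∈-map⁻ proj₁ (∈-resp-↭ (↭-sym arc-sources) u∈l)
      ... | a , a∈ , refl = contradiction
        (out-degree>in-degree dirac
          (λ v∉l a∈ a₁~v v~a₂ → no-insert (lose (∈-allFin _) (v∉l , lose a∈ (a₁~v , v~a₂))))
          (λ a∈P b∈P a₂~b₂ → no-cross (lose a∈P (lose b∈P a₂~b₂))))
        -- The arc leaving `u` belongs to `P`, which is therefore nonempty.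
        (¬in-degree<out-degree (λ a b → proj₂ a ~? proj₁ b) (∈-filter⁺ (λ a → x ~? proj₁ a) a∈ x~u))

  -- Connectivity and the two conclusions.

  -- The first step of the path that leaves `l` is such an edge, reversed.
  boundary-edge : Star _~_ u v → u ∈ l → v ∉ l → ∃₂ λ x y → x ∉ l × y ∈ l × x ~ y
  boundary-edge ε u∈l u∉l = contradiction u∈l u∉l
  boundary-edge {u} {l = l} (_◅_ {j = w} u~w w⇝v) u∈l v∉l with any? (w ≟_) l
  ... | yes w∈l = boundary-edge w⇝v w∈l v∉l
  ... | no w∉l  = w , u , w∉l , u∈l , ~-sym u~w

  -- Pigeonhole: otherwise all `n` vertices would embed into `l`.
  ∃∉ : (l : List (Fin n)) → length l < n → ∃ λ v → v ∉ l
  ∃∉ l l<n with any? (λ v → ¬? (any? (v ≟_) l)) (allFin n)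
  ... | yes found = let v , _ , v∉l = find found in v , v∉l
  ... | no none   = contradiction (begin
    n                  ≡⟨ length-tabulate id ⟨
    length (allFin n)  ≤⟨ Unique-⊆⇒length≤ (allFin⁺ n) all∈ ⟩
    length l           ∎) (<⇒≱ l<n)
    where
    open ≤-Reasoning
    all∈ : allFin n ⊆ l
    all∈ {v} v∈ with any? (v ≟_) l
    ... | yes v∈l = v∈l
    ... | no v∉l  = contradiction (lose v∈ v∉l) none

  cycle-extendable : Connected G → LocallyDirac G → (C : Cycle G) → Cycle.order C < n → Extendable G C
  cycle-extendable connected dirac C C<n with ∃∉ (Cycle.vertices C) C<n
  ... | v , v∉C with boundary-edge (connected (Cycle.start C) v) (here refl) v∉C
  ... | x , u , x∉C , u∈C , x~u with fromLinked _ _ (Cycle.closed C)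
  ... | t , W , e = extend C (ClosedWalk.insertion W e (Cycle.distinct C) x∉C dirac u∈C x~u)

  -- A path from `u` to some other vertex starts with an edge at `u`, and every edge lies in a
  -- triangle.
  on-triangle : n ≥ 3 → Connected G → LocallyDirac G → ∀ u → OnTriangle G u
  on-triangle n≥3 connected dirac u with ∃∉ (u ∷ []) (≤-trans (s≤s (s≤s z≤n)) n≥3)
  ... | z , z∉ with connected u z
  ... | ε = contradiction (here refl) z∉
  ... | _◅_ {j = v} u~v _ with edge-in-triangle dirac u~v
  ... | w , u~w , v~w
    with toCycle (u~v ∷ v~w ∷ [ w ]) (~-sym u~w) ≤-refl
           ((~⇒≢ u~v ∷ ~⇒≢ u~w ∷ []) ∷ (~⇒≢ v~w ∷ []) ∷ [] ∷ [])
    where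
    ~⇒≢ : ∀ {x y} → x ~ y → x ≢ y
    ~⇒≢ x~y refl = ~-irrefl refl x~y
  ... | C , refl = C , refl , here refl

corollary11 : ∀ {n : ℕ} (G : Graph n) → n ≥ 3 → Connected G → LocallyDirac G → FullyCycleExtendable G
corollary11 G n≥3 connected dirac = on-triangle G n≥3 connected dirac , cycle-extendable G connected dirac
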